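{- Let $n\ge 1$ be an integer and let $X_n\in\ell_n$ be any $n$-dimensional BC graph. Then $$\mathrm{MinLA}(X_n)=\sum_{i=1}^{2^n-1}\theta_{X_n}(i)=2^{n-1}(2^n-1).$$
   Context: Graphs are finite, simple and undirected. **Bijective connection.** Let $G_1=(V_1,E_1)$ and $G_2=(V_2,E_2)$ be two vertex-disjoint graphs of the same order. A bijective connection between $G_1$ and $G_2$ is an edge set $E=\{(v,\phi(v)) : v\in V_1\}$, where $\phi:V_1\to V_2$ is a bijection. Given such an $E$, one writes $G_1\oplus G_2=(V_1\cup V_2,\;E_1\cup E_2\cup E)$. This graph depends on the choice of $\phi$, and any bijection is allowed. **BC graphs.** The families $\ell_n$ ($n\ge1$) of $n$-dimensional BC (bijective connection) graphs are defined recursively, with graphs considered up to isomorphism. First, $\ell_1=\{K_2\}$, where $K_2$ is the complete graph on two vertices. For $n\ge2$, $G\in\ell_n$ if and only if $G=G_1\oplus G_2$ for some vertex-disjoint $G_1,G_2\in\ell_{n-1}$ and some bijective connection between them. An $n$-dimensional BC graph is denoted by $X_n$; it is $n$-regular with $2^n$ vertices. **Minimum linear arrangement.** A linear arrangement of a graph $G=(V,E)$ with $N$ vertices is a bijection $f:V\to\{1,2,\ldots,N\}$. Its cost is $LA_f(G)=\sum_{(u,v)\in E}|f(u)-f(v)|$. Equivalently, this is the wirelength of the embedding of $G$ into the path on $1,2,\ldots,N$ given by $f$: the sum, over path edges $e$, of the number of edges $(u,v)$ of $G$ such that $e$ lies on the path between $f(u)$ and $f(v)$. Define $\mathrm{MinLA}(G)=\min_f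 LA_f(G)$, the minimum over all linear arrangements $f$ of $G$. **Edge boundary.** For $A\subseteq V$, let $\theta_G(A)=\{(u,v)\in E: u\in A,\ v\notin A\}$. For an integer $m$ with $1\le m\le |V|$, let $\theta_G(m)=\min_{A\subseteq V,\ |A|=m}|\theta_G(A)|$. -}

module Defs where

open import Data.Bool using (Bool; true; false; not; T; T?)
open import Data.Fin using (Fin; zero; suc; toℕ; splitAt; punchIn; _≟_; _<?_)
open import Data.Fin.Permutation
  using (Permutation; Permutation′; _⟨$⟩ʳ_; id; insert; remove; _≈_; insert-remove)
open import Data.Fin.Subset using (Subset; inside; outside; ∣_∣; ⊥)
open import Data.Fin.Subset.Properties using (_∈?_; ∣⊥∣≡0)
open import Data.List
  using (List; []; _∷_; _++_; map; concatMap; filter; cartesianProduct; allFin; length)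
open import Data.List.Extrema.Nat using (min; min≤⊤; min≤xs; argmin-sel)
open import Data.List.Membership.Propositional using () renaming (_∈_ to _∈ₗ_)
open import Data.List.Membership.Propositional.Properties
  using (∈-map⁺; ∈-map⁻; ∈-++⁺ˡ; ∈-++⁺ʳ; ∈-concat⁺′; ∈-allFin; ∈-filter⁺; ∈-filter⁻)
open import Data.List.Properties using (map-cong)
open import Data.List.Relation.Unary.All using () renaming (lookup to All-lookup)
open import Data.List.Relation.Unary.Any using (here; there)
open import Data.Nat as ℕ using (ℕ; _+_; ∣_-_∣; _≤_; z≤n; s≤s)
open import Data.Nat.ListAction using (sum)
open import Data.Nat.Properties using (≤-trans; ≤-reflexive)
open import Data.Product using (∃; _×_; _,_; proj₂)
open import Data.Sum using (_⊎_; inj₁; inj₂)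
open import Data.Vec using ([]; _∷_)
open import Relation.Binary.PropositionalEquality
  using (_≡_; refl; sym; trans; cong; cong₂)
open import Relation.Nullary using (does; ¬?)
open import Relation.Nullary.Decidable using (_×-dec_)

------------------------------------------------------------------------
-- Graphs

-- Finite simple undirected graphs of order N, with vertex set Fin N.
record Graph (N : ℕ) : Set where
  field
    adj       : Fin N → Fin N → Bool
    symmetric : ∀ u v → adj u v ≡ adj v u
    loopless  : ∀ v → adj v v ≡ false

open Graph public

infix 4 _≅_

record _≅_ {M N : ℕ} (G : Graph M) (H : Graph N) : Set where
  field
    vertices : Permutation M N
    preserve : ∀ u v → adj G u v ≡ adj H (vertices ⟨$⟩ʳ u) (vertices ⟨$⟩ʳ v)

K₂ : Graph 2
K₂ = record
  { adj       = λ u v → not (does (u ≟ v))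
  ; symmetric = λ { zero zero → refl ; zero (suc zero) → refl
                  ; (suc zero) zero → refl ; (suc zero) (suc zero) → refl }
  ; loopless  = λ { zero → refl ; (suc zero) → refl }
  }

-- G₁ ⊕[ φ ] G₂ is the disjoint union of G₁ and G₂ together with the edges
-- (v , φ v) for v a vertex of G₁.  Fin (N + N) is read as the disjoint
-- union Fin N ⊎ Fin N through splitAt.
module _ {N : ℕ} (G₁ : Graph N) (φ : Permutation′ N) (G₂ : Graph N) where

  ⊕-adj : Fin N ⊎ Fin N → Fin N ⊎ Fin N → Bool
  ⊕-adj (inj₁ u) (inj₁ v) = adj G₁ u v
  ⊕-adj (inj₁ u) (inj₂ v) = does (φ ⟨$⟩ʳ u ≟ v)
  ⊕-adj (inj₂ u) (inj₁ v) = does (φ ⟨$⟩ʳ v ≟ u)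
  ⊕-adj (inj₂ u) (inj₂ v) = adj G₂ u v

  ⊕-symmetric : ∀ x y → ⊕-adj x y ≡ ⊕-adj y x
  ⊕-symmetric (inj₁ u) (inj₁ v) = symmetric G₁ u v
  ⊕-symmetric (inj₁ u) (inj₂ v) = refl
  ⊕-symmetric (inj₂ u) (inj₁ v) = refl
  ⊕-symmetric (inj₂ u) (inj₂ v) = symmetric G₂ u v

  ⊕-loopless : ∀ x → ⊕-adj x x ≡ false
  ⊕-loopless (inj₁ v) = loopless G₁ v
  ⊕-loopless (inj₂ v) = loopless G₂ v

  _⊕[_]_ : Graph (N + N)
  _⊕[_]_ = record
    { adj       = λ u v → ⊕-adj (splitAt N u) (splitAt N v)
    ; symmetric = λ u v → ⊕-symmetric (splitAt N u) (splitAt N v)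
    ; loopless  = λ v → ⊕-loopless (splitAt N v)
    }

-- The n-dimensional BC graphs, a family closed under isomorphism.  There is
-- no constructor for ℓ 0, so the graphs built by join have dimension ≥ 2.
data ℓ : ℕ → {N : ℕ} → Graph N → Set where
  base : ∀ {N} {G : Graph N} → G ≅ K₂ → ℓ 1 G
  join : ∀ {n M N} {G : Graph M} {G₁ G₂ : Graph N} (φ : Permutation′ N) →
         ℓ n G₁ → ℓ n G₂ → G ≅ G₁ ⊕[ φ ] G₂ → ℓ (ℕ.suc n) G

------------------------------------------------------------------------
-- Minima over finite families

-- The value at [] is a convention.
minimum : List ℕ → ℕ
minimum []       = 0
minimum (x ∷ xs) = min x xs

minimum-∈ : ∀ {x xs} → x ∈ₗ xs → minimum xs ∈ₗ xs
minimum-∈ {xs = y ∷ ys} _ with argmin-sel (λ k → k) y ys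
... | inj₁ eq = here eq
... | inj₂ k∈ = there k∈

minimum-≤ : ∀ {x xs} → x ∈ₗ xs → minimum xs ≤ x
minimum-≤ {xs = y ∷ ys} (here refl) = min≤⊤ y ys
minimum-≤ {xs = y ∷ ys} (there x∈)  = All-lookup (min≤xs y ys) x∈

-- A permutation of Fin (suc n) is determined by the image i of zero and by
-- the permutation of Fin n that remains after removing zero and i.
allPermutations : ∀ n → List (Permutation′ n)
allPermutations ℕ.zero    = id ∷ []
allPermutations (ℕ.suc n) =
  concatMap (λ i → map (insert zero i) (allPermutations n)) (allFin (ℕ.suc n))

-- Permutations carry proofs, so completeness is up to pointwise equality.
allPermutations-complete : ∀ {n} (π : Permutation′ n) →
                           ∃ λ ρ → ρ ∈ₗ allPermutations n × ρ ≈ π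
allPermutations-complete {ℕ.zero}  π = id , here refl , λ ()
allPermutations-complete {ℕ.suc n} π
  with allPermutations-complete (remove zero π)
... | ρ , ρ∈ , ρ≈ =
  insert zero (π ⟨$⟩ʳ zero) ρ
  , ∈-concat⁺′ (∈-map⁺ (insert zero _) ρ∈)
               (∈-map⁺ (λ i → map (insert zero i) (allPermutations n)) (∈-allFin (π ⟨$⟩ʳ zero)))
  , λ j → trans (insert-cong j) (insert-remove zero π j)
  where
  insert-cong : insert zero (π ⟨$⟩ʳ zero) ρ ≈ insert zero (π ⟨$⟩ʳ zero) (remove zero π)
  insert-cong zero    = refl
  insert-cong (suc j) = cong (punchIn (π ⟨$⟩ʳ zero)) (ρ≈ j)

allSubsets : ∀ n → List (Subset n)
allSubsets ℕ.zero    = [] ∷ []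
allSubsets (ℕ.suc n) = map (outside ∷_) (allSubsets n) ++ map (inside ∷_) (allSubsets n)

allSubsets-complete : ∀ {n} (A : Subset n) → A ∈ₗ allSubsets n
allSubsets-complete []          = here refl
allSubsets-complete (false ∷ A) = ∈-++⁺ˡ (∈-map⁺ (outside ∷_) (allSubsets-complete A))
allSubsets-complete (true ∷ A)  =
  ∈-++⁺ʳ (map (outside ∷_) (allSubsets _)) (∈-map⁺ (inside ∷_) (allSubsets-complete A))

subsetOfSize : ∀ {m n} → m ≤ n → ∃ λ (A : Subset n) → ∣ A ∣ ≡ m
subsetOfSize {n = n} z≤n = ⊥ , ∣⊥∣≡0 n
subsetOfSize (s≤s m≤n) with subsetOfSize m≤n
... | A , eq = inside ∷ A , cong ℕ.suc eq

------------------------------------------------------------------------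
-- Linear arrangements and edge boundaries

module _ {N : ℕ} (G : Graph N) where

  -- Each undirected edge is listed once, with its smaller endpoint first.
  edges : List (Fin N × Fin N)
  edges = filter (λ (u , v) → (u <? v) ×-dec T? (adj G u v))
                 (cartesianProduct (allFin N) (allFin N))

  -- A linear arrangement V → {1, …, N}; positions in Fin N are shifted by one.
  position : Permutation′ N → Fin N → ℕ
  position f v = ℕ.suc (toℕ (f ⟨$⟩ʳ v))

  LA : Permutation′ N → ℕ
  LA f = sum (map (λ (u , v) → ∣ position f u - position f v ∣) edges)

  MinLA : ℕ
  MinLA = minimum (map LA (allPermutations N))

  LA-cong : ∀ {f g} → f ≈ g → LA f ≡ LA g
  LA-cong f≈g = cong sum (map-cong (λ (u , v) → cong₂ (λ i j → ∣ ℕ.suc (toℕ i) - ℕ.suc (toℕ j) ∣)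
                                                        (f≈g u) (f≈g v)) edges)

  MinLA-attained : ∃ λ f → LA f ≡ MinLA
  MinLA-attained
    with allPermutations-complete (id {N})
  ... | _ , ρ∈ , _ with ∈-map⁻ LA (minimum-∈ (∈-map⁺ LA ρ∈))
  ... | f , _ , eq = f , sym eq

  MinLA-≤ : ∀ f → MinLA ≤ LA f
  MinLA-≤ f with allPermutations-complete f
  ... | ρ , ρ∈ , ρ≈f = ≤-trans (minimum-≤ (∈-map⁺ LA ρ∈)) (≤-reflexive (LA-cong {ρ} {f} ρ≈f))

  -- A crossing edge has exactly one orientation (u , v) with u ∈ A and v ∉ A,
  -- so ranging over ordered pairs lists each edge of the boundary once.
  boundary : Subset N → List (Fin N × Fin N)
  boundary A = filter (λ (u , v) → T? (adj G u v) ×-dec ((u ∈? A) ×-dec ¬? (v ∈? A)))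
                      (cartesianProduct (allFin N) (allFin N))

  -- Only meaningful for m ≤ N; otherwise there is no A with ∣ A ∣ ≡ m.
  θ : ℕ → ℕ
  θ m = minimum (map (λ A → length (boundary A))
                     (filter (λ A → ∣ A ∣ ℕ.≟ m) (allSubsets N)))

  private
    ∈-θ : ∀ A → length (boundary A) ∈ₗ
          map (λ B → length (boundary B)) (filter (λ B → ∣ B ∣ ℕ.≟ ∣ A ∣) (allSubsets N))
    ∈-θ A = ∈-map⁺ (λ B → length (boundary B))
                   (∈-filter⁺ (λ B → ∣ B ∣ ℕ.≟ ∣ A ∣) (allSubsets-complete A) refl)

  θ-≤ : ∀ A → θ ∣ A ∣ ≤ length (boundary A)
  θ-≤ A = minimum-≤ (∈-θ A)

  θ-attained : ∀ {m} → m ≤ N → ∃ λ A → ∣ A ∣ ≡ m × length (boundary A) ≡ θ m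
  θ-attained m≤N with subsetOfSize m≤N
  ... | A , refl with ∈-map⁻ (λ B → length (boundary B)) (minimum-∈ (∈-θ A))
  ... | B , B∈ , eq =
    B , proj₂ (∈-filter⁻ (λ C → ∣ C ∣ ℕ.≟ ∣ A ∣) {xs = allSubsets N} B∈) , sym eq

{-# OPTIONS --safe #-}
-- Let E n m be the number of edges that the n-cube has among its first m
-- vertices in binary order.  Since E n a + E n c + min a c ≤ E (n + 1) (a + c),
-- induction on the BC structure shows that an m-set A has at least
-- n m − 2 E n m boundary edges: the matching contributes at least ||A₁| − |A₂||
-- for the two halves A₁, A₂ of A.  Summed over 0 < m < 2ⁿ these bounds give
-- 2ⁿ⁻¹(2ⁿ − 1).  On the other hand the cost of an arrangement is the sum of the
-- boundaries of its initial segments, hence at least ∑ θ(m), and listing one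
-- half after the other, recursively, costs exactly 2ⁿ⁻¹(2ⁿ − 1): if this is C n,
-- then C (n + 1) = 2 C n + 4ⁿ, whatever the matching.  So all the inequalities
-- between the three quantities are equalities.
module Submission where

open import Defs
open import Data.Nat using (ℕ; suc; _+_; _*_; _∸_; _^_; _≤_)
open import Data.Nat.ListAction using (sum)
open import Data.List using (applyUpTo)
open import Data.Product using (_×_)
open import Relation.Binary.PropositionalEquality using (_≡_)

open import Data.Nat.Properties hiding (_≟_; _<?_; <-cmp)
open import Algebra.Properties.Semiring.Sum +-*-semiring
  using (sum-syntax; sum-cong-≗; ∑-distrib-+; ∑-comm; ∑-permute; *-distribˡ-sum; sum-replicate-zero)
open import Data.Bool using (Bool; true; false; not; _∧_)
open import Data.Fin using (Fin; zero; suc; toℕ; splitAt; _≟_; _<?_) renaming (join to ⊎⇒Fin)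
open import Data.Fin.Permutation
  using (Permutation′; _⟨$⟩ʳ_; _⟨$⟩ˡ_; _∘ₚ_; id; flip; inverseʳ; ↔⇒≡)
open import Data.Fin.Properties
  using (join-splitAt; +↔⊎; toℕ-↑ˡ; toℕ-↑ʳ; toℕ<n; <-cmp)
open import Data.Fin.Subset using (Subset; ∣_∣)
open import Data.Fin.Subset.Properties using (_∈?_)
open import Data.List using (List; []; _∷_; _++_; map; filter; cartesianProduct; tabulate; allFin; length)
open import Data.List.Properties using (map-++; map-∘)
open import Data.Nat using (zero; pred; z≤n; s≤s; ⌊_/2⌋; ⌈_/2⌉; _<ᵇ_; ∣_-_∣)
open import Data.Nat.ListAction.Properties using (sum-++)
open import Data.Nat.Tactic.RingSolver using (solve-∀)
open import Data.Product using (_,_; proj₁; proj₂)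
open import Data.Sum using (_⊎_; inj₁; inj₂)
import Data.Sum as Sum
open import Data.Sum.Function.Propositional using (_⊎-↔_)
import Data.Vec as Vec
open import Data.Vec.Properties using (lookup∘tabulate)
open import Function using (_∘_; const)
open import Level using (0ℓ)
open import Function.Construct.Composition using (_↔-∘_)
open import Function.Construct.Symmetry using (↔-sym)
open import Relation.Binary.Definitions using (tri<; tri≈; tri>)
open import Relation.Binary.PropositionalEquality
  using (refl; sym; trans; cong; cong₂; subst; subst₂; module ≡-Reasoning)
open import Relation.Nullary using (does; contradiction)
open import Relation.Nullary.Decidable using (dec-true; dec-false)
open import Relation.Unary using (Pred; Decidable)

private
  variable
    m n M N : ℕ

-- Truth values as numbers and sums over finite index types.

bit : Bool → ℕ
bit false = 0
bit true  = 1

bit-∧ : ∀ a b → bit (a ∧ b) ≡ bit a * bit b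
bit-∧ false b = refl
bit-∧ true  b = sym (+-identityʳ (bit b))

∑-mono-≤ : ∀ {n} {f g : Fin n → ℕ} → (∀ i → f i ≤ g i) → ∑[ i < n ] f i ≤ ∑[ i < n ] g i
∑-mono-≤ {zero}  f≤g = z≤n
∑-mono-≤ {suc n} f≤g = +-mono-≤ (f≤g zero) (∑-mono-≤ (f≤g ∘ suc))

∑-splitAt : ∀ m {n} (f : Fin m ⊎ Fin n → ℕ) →
            ∑[ i < m + n ] f (splitAt m i) ≡ ∑[ i < m ] f (inj₁ i) + ∑[ j < n ] f (inj₂ j)
∑-splitAt zero    f = refl
∑-splitAt (suc m) f = trans (cong (f (inj₁ zero) +_) (∑-splitAt m (f ∘ Sum.map₁ suc)))
                            (sym (+-assoc (f (inj₁ zero)) _ _))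

∑-const : ∀ n c → ∑[ i < n ] c ≡ n * c
∑-const zero    c = refl
∑-const (suc n) c = cong (c +_) (∑-const n c)

∑-δ : (w : Fin n) (f : Fin n → ℕ) → ∑[ v < n ] (bit (does (w ≟ v)) * f v) ≡ f w
∑-δ {suc n} zero    f = trans (cong₂ _+_ (+-identityʳ (f zero)) (sum-replicate-zero n)) (+-identityʳ (f zero))
∑-δ {suc n} (suc w) f = ∑-δ w (f ∘ suc)

∑-toℕ : ∀ n → 2 * ∑[ i < n ] toℕ i + n ≡ n * n
∑-toℕ zero    = refl
∑-toℕ (suc n) = begin
  2 * ∑[ i < n ] suc (toℕ i) + suc n         ≡⟨ cong (λ s → 2 * s + suc n) (∑-distrib-+ {n} (const 1) toℕ) ⟩
  2 * (∑[ i < n ] 1 + ∑[ i < n ] toℕ i) + suc n ≡⟨ cong (λ s → 2 * (s + ∑[ i < n ] toℕ i) + suc n) (∑-const n 1) ⟩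
  2 * (n * 1 + ∑[ i < n ] toℕ i) + suc n     ≡⟨ shuffle n (∑[ i < n ] toℕ i) ⟩
  (2 * ∑[ i < n ] toℕ i + n) + (n + suc n)   ≡⟨ cong (_+ (n + suc n)) (∑-toℕ n) ⟩
  n * n + (n + suc n)                        ≡⟨ square n ⟩
  suc n * suc n                              ∎
  where
  open ≡-Reasoning
  shuffle : ∀ n s → 2 * (n * 1 + s) + suc n ≡ (2 * s + n) + (n + suc n)
  shuffle = solve-∀
  square : ∀ n → n * n + (n + suc n) ≡ suc n * suc n
  square = solve-∀

∑-shift : ∀ n (f : ℕ → ℕ) → f 0 + ∑[ i < n ] f (suc (toℕ i)) ≡ ∑[ i < n ] f (toℕ i) + f n
∑-shift zero    f = +-identityʳ (f 0)
∑-shift (suc n) f = trans (cong (f 0 +_) (∑-shift n (f ∘ suc))) (sym (+-assoc (f 0) _ _))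

-- Grouping the indices `2i` and `2i + 1` is what lets the halving recursion of `maxEdges` be summed
-- over a full range.
∑-double : ∀ n (f : ℕ → ℕ) →
           ∑[ i < n + n ] f (toℕ i) ≡ ∑[ i < n ] (f (toℕ i + toℕ i) + f (suc (toℕ i + toℕ i)))
∑-double zero    f = refl
∑-double (suc n) f = begin
  f 0 + ∑[ i < n + suc n ] f (suc (toℕ i))           ≡⟨ cong (λ k → f 0 + ∑[ i < k ] f (suc (toℕ i))) (+-suc n n) ⟩
  f 0 + (f 1 + ∑[ i < n + n ] f (suc (suc (toℕ i)))) ≡⟨ +-assoc (f 0) (f 1) _ ⟨
  f 0 + f 1 + ∑[ i < n + n ] f (suc (suc (toℕ i)))   ≡⟨ cong (f 0 + f 1 +_) (∑-double n (λ j → f (suc (suc j)))) ⟩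
  f 0 + f 1 + ∑[ i < n ] (f (suc (suc (toℕ i + toℕ i))) + f (suc (suc (suc (toℕ i + toℕ i)))))
    ≡⟨ cong (f 0 + f 1 +_) (sum-cong-≗ λ (i : Fin n) → cong (λ j → f (suc j) + f (suc (suc j))) (sym (+-suc (toℕ i) (toℕ i)))) ⟩
  f 0 + f 1 + ∑[ i < n ] (f (suc (toℕ i) + suc (toℕ i)) + f (suc (suc (toℕ i) + suc (toℕ i)))) ∎
  where open ≡-Reasoning

sum-applyUpTo : ∀ (f : ℕ → ℕ) n → sum (applyUpTo f n) ≡ ∑[ i < n ] f (toℕ i)
sum-applyUpTo f zero    = refl
sum-applyUpTo f (suc n) = cong (f 0 +_) (sum-applyUpTo (f ∘ suc) n)

-- Edge counts of initial segments of the cube.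

-- The number of edges of Q_k spanned by an initial segment of m ≤ 2^k vertices
-- in binary order; splitting on the last coordinate gives the recursion.
maxEdges : ℕ → ℕ → ℕ
maxEdges zero    m = 0
maxEdges (suc k) m = maxEdges k ⌊ m /2⌋ + maxEdges k ⌈ m /2⌉ + ⌊ m /2⌋

maxEdges-even : ∀ k m → maxEdges (suc k) (m + m) ≡ maxEdges k m + maxEdges k m + m
maxEdges-even k m rewrite sym (n≡⌊n+n/2⌋ m) | sym (n≡⌈n+n/2⌉ m) = refl

maxEdges-odd : ∀ k m → maxEdges (suc k) (suc (m + m)) ≡ maxEdges k m + maxEdges k (suc m) + m
maxEdges-odd k m rewrite sym (n≡⌊n+n/2⌋ m) | sym (n≡⌈n+n/2⌉ m) = refl

maxEdges-zero : ∀ k → maxEdges k 0 ≡ 0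
maxEdges-zero zero    = refl
maxEdges-zero (suc k) rewrite maxEdges-zero k = refl

data Parity : ℕ → Set where
  even : ∀ m → Parity (m + m)
  odd  : ∀ m → Parity (suc (m + m))

parity : ∀ n → Parity n
parity zero = even 0
parity (suc n) with parity n
... | even m = odd m
... | odd m  = subst Parity (cong suc (+-suc m m)) (even (suc m))

⌊half⌋-≤ : ∀ {t} m → t ≤ suc (m + m) → ⌊ t /2⌋ ≤ m
⌊half⌋-≤ m t≤ = ≤-trans (⌊n/2⌋-mono t≤) (≤-reflexive (sym (n≡⌈n+n/2⌉ m)))

⌈half⌉-≤ : ∀ {t} m → t ≤ m + m → ⌈ t /2⌉ ≤ m
⌈half⌉-≤ m t≤ = ≤-trans (⌈n/2⌉-mono t≤) (≤-reflexive (sym (n≡⌈n+n/2⌉ m)))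

⌈half⌉-≤-suc : ∀ {t} m → t ≤ suc (m + m) → ⌈ t /2⌉ ≤ suc m
⌈half⌉-≤-suc m t≤ = ≤-trans (⌈n/2⌉-mono t≤) (≤-reflexive (cong suc (sym (n≡⌊n+n/2⌋ m))))

-- Induction on `k`: `a`, `c` and `t` are each split into a lower and an upper half, the halves of
-- `a` are paired with those of `c`, and the induction hypothesis is applied to both pairs. The
-- linear terms of the recursion add up separately. Any common lower bound `t` is allowed in place
-- of the minimum, because in the application `t` counts the matching edges inside a vertex set.
maxEdges-superadditive : ∀ k {a c t} → t ≤ a → t ≤ c →
                         maxEdges k a + maxEdges k c + t ≤ maxEdges (suc k) (a + c)
maxEdges-superadditive zero {a} {c} {t} t≤a t≤c = begin
  t               ≡⟨ n≡⌊n+n/2⌋ t ⟩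
  ⌊ t + t /2⌋     ≤⟨ ⌊n/2⌋-mono (+-mono-≤ t≤a t≤c) ⟩
  ⌊ a + c /2⌋     ∎
  where open ≤-Reasoning
maxEdges-superadditive (suc k) {a} {c} {t} t≤a t≤c = split (parity a) (parity c) t≤a t≤c
  where
  open ≤-Reasoning
  E = maxEdges k
  E′ = maxEdges (suc k)
  E″ = maxEdges (suc (suc k))
  t≡ : t ≡ ⌊ t /2⌋ + ⌈ t /2⌉
  t≡ = sym (⌊n/2⌋+⌈n/2⌉≡n t)

  IH : ∀ {a c t} → t ≤ a → t ≤ c → E a + E c + t ≤ E′ (a + c)
  IH = maxEdges-superadditive k

  even-odd : ∀ a c → t ≤ a + a → t ≤ suc (c + c) →
             E′ (a + a) + E′ (suc (c + c)) + t ≤ E″ (suc ((a + c) + (a + c)))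
  even-odd a c t≤a t≤c = begin
    E′ (a + a) + E′ (suc (c + c)) + t
      ≡⟨ cong₂ _+_ (cong₂ _+_ (maxEdges-even k a) (maxEdges-odd k c)) t≡ ⟩
    E a + E a + a + (E c + E (suc c) + c) + (⌊ t /2⌋ + ⌈ t /2⌉)
      ≡⟨ shuffle (E a) (E c) (E (suc c)) a c ⌊ t /2⌋ ⌈ t /2⌉ ⟩
    (E a + E c + ⌊ t /2⌋) + (E a + E (suc c) + ⌈ t /2⌉) + (a + c)
      ≤⟨ +-monoˡ-≤ (a + c) (+-mono-≤
           (IH (⌊half⌋-≤ a (m≤n⇒m≤1+n t≤a)) (⌊half⌋-≤ c t≤c))
           (IH (⌈half⌉-≤ a t≤a) (⌈half⌉-≤-suc c t≤c))) ⟩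
    E′ (a + c) + E′ (a + suc c) + (a + c)
      ≡⟨ cong (λ j → E′ (a + c) + E′ j + (a + c)) (+-suc a c) ⟩
    E′ (a + c) + E′ (suc (a + c)) + (a + c)
      ≡⟨ maxEdges-odd (suc k) (a + c) ⟨
    E″ (suc ((a + c) + (a + c))) ∎
    where
    shuffle : ∀ A C C₁ a c x y → A + A + a + (C + C₁ + c) + (x + y)
                               ≡ (A + C + x) + (A + C₁ + y) + (a + c)
    shuffle = solve-∀

  split : ∀ {a c} → Parity a → Parity c → t ≤ a → t ≤ c → E′ a + E′ c + t ≤ E″ (a + c)
  split (even a) (even c) t≤a t≤c = begin
    E′ (a + a) + E′ (c + c) + t
      ≡⟨ cong₂ _+_ (cong₂ _+_ (maxEdges-even k a) (maxEdges-even k c)) t≡ ⟩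
    E a + E a + a + (E c + E c + c) + (⌊ t /2⌋ + ⌈ t /2⌉)
      ≡⟨ shuffle (E a) (E c) a c ⌊ t /2⌋ ⌈ t /2⌉ ⟩
    (E a + E c + ⌊ t /2⌋) + (E a + E c + ⌈ t /2⌉) + (a + c)
      ≤⟨ +-monoˡ-≤ (a + c) (+-mono-≤
           (IH (⌊half⌋-≤ a (m≤n⇒m≤1+n t≤a)) (⌊half⌋-≤ c (m≤n⇒m≤1+n t≤c)))
           (IH (⌈half⌉-≤ a t≤a) (⌈half⌉-≤ c t≤c))) ⟩
    E′ (a + c) + E′ (a + c) + (a + c)
      ≡⟨ maxEdges-even (suc k) (a + c) ⟨
    E″ ((a + c) + (a + c))
      ≡⟨ cong E″ (interchange a c) ⟩
    E″ ((a + a) + (c + c)) ∎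
    where
    shuffle : ∀ A C a c x y → A + A + a + (C + C + c) + (x + y)
                            ≡ (A + C + x) + (A + C + y) + (a + c)
    shuffle = solve-∀
    interchange : ∀ a c → (a + c) + (a + c) ≡ (a + a) + (c + c)
    interchange = solve-∀
  split (even a) (odd c) t≤a t≤c =
    ≤-trans (even-odd a c t≤a t≤c) (≤-reflexive (cong E″ (interchange a c)))
    where
    interchange : ∀ a c → suc ((a + c) + (a + c)) ≡ (a + a) + suc (c + c)
    interchange = solve-∀
  split (odd a) (even c) t≤a t≤c = begin
    E′ (suc (a + a)) + E′ (c + c) + t
      ≡⟨ cong (_+ t) (+-comm (E′ (suc (a + a))) (E′ (c + c))) ⟩
    E′ (c + c) + E′ (suc (a + a)) + t
      ≤⟨ even-odd c a t≤c t≤a ⟩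
    E″ (suc ((c + a) + (c + a)))
      ≡⟨ cong E″ (interchange a c) ⟩
    E″ (suc (a + a) + (c + c)) ∎
    where
    interchange : ∀ a c → suc ((c + a) + (c + a)) ≡ suc (a + a) + (c + c)
    interchange = solve-∀
  split (odd a) (odd c) t≤a t≤c = begin
    E′ (suc (a + a)) + E′ (suc (c + c)) + t
      ≡⟨ cong₂ _+_ (cong₂ _+_ (maxEdges-odd k a) (maxEdges-odd k c)) t≡ ⟩
    E a + E (suc a) + a + (E c + E (suc c) + c) + (⌊ t /2⌋ + ⌈ t /2⌉)
      -- Each lower half is now paired with the upper half of the other number, so both pairs have
      -- sum `a + c + 1`. Half of the total exceeds `a + c` by one, and this unit pays for rounding
      -- `t` up.
      ≤⟨ +-monoʳ-≤ (E a + E (suc a) + a + (E c + E (suc c) + c)) (+-monoʳ-≤ ⌊ t /2⌋ (⌊n/2⌋-mono (n≤1+n (suc t)))) ⟩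
    E a + E (suc a) + a + (E c + E (suc c) + c) + (⌊ t /2⌋ + suc ⌊ t /2⌋)
      ≡⟨ shuffle (E a) (E (suc a)) (E c) (E (suc c)) a c ⌊ t /2⌋ ⟩
    (E a + E (suc c) + ⌊ t /2⌋) + (E (suc a) + E c + ⌊ t /2⌋) + suc (a + c)
      ≤⟨ +-monoˡ-≤ (suc (a + c)) (+-mono-≤
           (IH (⌊half⌋-≤ a t≤a) (m≤n⇒m≤1+n (⌊half⌋-≤ c t≤c)))
           (IH (m≤n⇒m≤1+n (⌊half⌋-≤ a t≤a)) (⌊half⌋-≤ c t≤c))) ⟩
    E′ (a + suc c) + E′ (suc (a + c)) + suc (a + c)
      ≡⟨ cong (λ j → E′ j + E′ (suc (a + c)) + suc (a + c)) (+-suc a c) ⟩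
    E′ (suc (a + c)) + E′ (suc (a + c)) + suc (a + c)
      ≡⟨ maxEdges-even (suc k) (suc (a + c)) ⟨
    E″ (suc (a + c) + suc (a + c))
      ≡⟨ cong E″ (interchange a c) ⟩
    E″ (suc (a + a) + suc (c + c)) ∎
    where
    shuffle : ∀ A A₁ C C₁ a c x → A + A₁ + a + (C + C₁ + c) + (x + suc x)
                                ≡ (A + C₁ + x) + (A₁ + C + x) + suc (a + c)
    shuffle = solve-∀
    interchange : ∀ a c → suc (a + c) + suc (a + c) ≡ suc (a + a) + suc (c + c)
    interchange = solve-∀

2^-double : ∀ k → 2 ^ suc k ≡ 2 ^ k + 2 ^ k
2^-double k = cong (2 ^ k +_) (+-identityʳ (2 ^ k))

-- The degree sum of the whole k-cube. It evaluates the end term that appears when the sum of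
-- `maxEdges n (i + 1)` is shifted to start at 0.
maxEdges-2^ : ∀ k → 2 * maxEdges k (2 ^ k) ≡ k * 2 ^ k
maxEdges-2^ zero    = refl
maxEdges-2^ (suc k) rewrite 2^-double k | maxEdges-even k (2 ^ k) =
  trans (shuffle (maxEdges k (2 ^ k)) (2 ^ k))
        (trans (cong (λ e → e + e + 2 * 2 ^ k) (maxEdges-2^ k)) (collect k (2 ^ k)))
  where
  shuffle : ∀ e p → 2 * (e + e + p) ≡ 2 * e + 2 * e + 2 * p
  shuffle = solve-∀
  collect : ∀ k p → k * p + k * p + 2 * p ≡ suc k * (p + p)
  collect = solve-∀

-- Equivalent to 4 ∑ maxEdges n m = (n ∸ 1)(4^n ∸ 2^n), with both sides moved
-- so that no subtraction occurs.
∑-maxEdges : ∀ n → 4 * ∑[ i < 2 ^ n ] maxEdges n (toℕ i) + (2 ^ n * 2 ^ n + n * 2 ^ n)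
                   ≡ n * (2 ^ n * 2 ^ n) + 2 ^ n
∑-maxEdges zero    = refl
∑-maxEdges (suc n) = begin
  4 * ∑[ i < 2 ^ suc n ] E′ (toℕ i) + (2 ^ suc n * 2 ^ suc n + suc n * 2 ^ suc n)
    ≡⟨ cong (λ q → 4 * ∑[ i < q ] E′ (toℕ i) + (q * q + suc n * q)) (2^-double n) ⟩
  4 * ∑[ i < P + P ] E′ (toℕ i) + ((P + P) * (P + P) + suc n * (P + P))
    ≡⟨ cong (λ s → 4 * s + ((P + P) * (P + P) + suc n * (P + P))) ∑E′ ⟩
  4 * (3 * H + (H + E P) + 2 * T) + ((P + P) * (P + P) + suc n * (P + P))
    ≡⟨ shuffle₁ n P H (E P) T ⟩
  16 * H + 2 * (2 * E P) + (8 * T + 4 * (P * P) + 2 * P + 2 * (n * P))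
    ≡⟨ cong (λ x → 16 * H + 2 * x + (8 * T + 4 * (P * P) + 2 * P + 2 * (n * P))) (maxEdges-2^ n) ⟩
  16 * H + 2 * (n * P) + (8 * T + 4 * (P * P) + 2 * P + 2 * (n * P))
    ≡⟨ shuffle₂ n P H T ⟩
  4 * (4 * H + (P * P + n * P)) + (8 * T + 2 * P)
    ≡⟨ cong (λ x → 4 * x + (8 * T + 2 * P)) (∑-maxEdges n) ⟩
  4 * (n * (P * P) + P) + (8 * T + 2 * P)
    ≡⟨ shuffle₃ n P T ⟩
  4 * (n * (P * P)) + 4 * (2 * T + P) + 2 * P
    ≡⟨ cong (λ x → 4 * (n * (P * P)) + 4 * x + 2 * P) (∑-toℕ P) ⟩
  4 * (n * (P * P)) + 4 * (P * P) + 2 * P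
    ≡⟨ shuffle₄ n P ⟩
  suc n * ((P + P) * (P + P)) + (P + P)
    ≡⟨ cong (λ q → suc n * (q * q) + q) (2^-double n) ⟨
  suc n * (2 ^ suc n * 2 ^ suc n) + 2 ^ suc n ∎
  where
  open ≡-Reasoning
  P = 2 ^ n
  E = maxEdges n
  E′ = maxEdges (suc n)
  H = ∑[ i < P ] E (toℕ i)
  T = ∑[ i < P ] toℕ i
  shuffle₁ : ∀ n P H e t → 4 * (3 * H + (H + e) + 2 * t) + ((P + P) * (P + P) + suc n * (P + P))
                         ≡ 16 * H + 2 * (2 * e) + (8 * t + 4 * (P * P) + 2 * P + 2 * (n * P))
  shuffle₁ = solve-∀
  shuffle₂ : ∀ n P H t → 16 * H + 2 * (n * P) + (8 * t + 4 * (P * P) + 2 * P + 2 * (n * P))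
                       ≡ 4 * (4 * H + (P * P + n * P)) + (8 * t + 2 * P)
  shuffle₂ = solve-∀
  shuffle₃ : ∀ n P t → 4 * (n * (P * P) + P) + (8 * t + 2 * P)
                     ≡ 4 * (n * (P * P)) + 4 * (2 * t + P) + 2 * P
  shuffle₃ = solve-∀
  shuffle₄ : ∀ n P → 4 * (n * (P * P)) + 4 * (P * P) + 2 * P
                   ≡ suc n * ((P + P) * (P + P)) + (P + P)
  shuffle₄ = solve-∀
  -- The indices `2i` and `2i + 1` together give `E i` three times, `E (i + 1)` once, and `2i`.
  -- Shifting the second kind of term by one index turns it into `H + E P`, since `E 0` is 0.
  ∑E′ : ∑[ i < P + P ] E′ (toℕ i) ≡ 3 * H + (H + E P) + 2 * T
  ∑E′ = begin
    ∑[ i < P + P ] E′ (toℕ i)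
      ≡⟨ ∑-double P E′ ⟩
    ∑[ i < P ] (E′ (toℕ i + toℕ i) + E′ (suc (toℕ i + toℕ i)))
      ≡⟨ sum-cong-≗ (λ (i : Fin P) → trans (cong₂ _+_ (maxEdges-even n (toℕ i)) (maxEdges-odd n (toℕ i)))
                                           (regroup (E (toℕ i)) (E (suc (toℕ i))) (toℕ i))) ⟩
    ∑[ i < P ] (3 * E (toℕ i) + E (suc (toℕ i)) + 2 * toℕ i)
      ≡⟨ ∑-distrib-+ {P} _ _ ⟩
    ∑[ i < P ] (3 * E (toℕ i) + E (suc (toℕ i))) + ∑[ i < P ] (2 * toℕ i)
      ≡⟨ cong₂ _+_ (∑-distrib-+ {P} _ _) (sym (*-distribˡ-sum {P} 2 toℕ)) ⟩
    ∑[ i < P ] (3 * E (toℕ i)) + ∑[ i < P ] E (suc (toℕ i)) + 2 * T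
      ≡⟨ cong (_+ 2 * T) (cong₂ _+_ (sym (*-distribˡ-sum {P} 3 (E ∘ toℕ)))
                                    (trans (cong (_+ ∑[ i < P ] E (suc (toℕ i))) (sym (maxEdges-zero n))) (∑-shift P E))) ⟩
    3 * H + (H + E P) + 2 * T ∎
    where
    regroup : ∀ e e₁ i → e + e + i + (e + e₁ + i) ≡ 3 * e + e₁ + 2 * i
    regroup = solve-∀

-- Weighted sums over oriented edges.

-- Both orientations of an edge occur, and the weight need not be symmetric. Cut sizes and
-- arrangement costs are the instances in which at most one orientation has nonzero weight, so their
-- behaviour under isomorphism and under `⊕` is computed only once.
arcSum : Graph N → (Fin N → Fin N → ℕ) → ℕ
arcSum {N} G d = ∑[ u < N ] ∑[ v < N ] (bit (adj G u v) * d u v)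

∑∑-cong : {f g : Fin M → Fin N → ℕ} → (∀ u v → f u v ≡ g u v) →
          ∑[ u < M ] ∑[ v < N ] f u v ≡ ∑[ u < M ] ∑[ v < N ] g u v
∑∑-cong f≗g = sum-cong-≗ λ u → sum-cong-≗ (f≗g u)

arcSum-cong : (G : Graph N) {d e : Fin N → Fin N → ℕ} → (∀ u v → d u v ≡ e u v) →
              arcSum G d ≡ arcSum G e
arcSum-cong G d≗e = ∑∑-cong λ u v → cong (bit (adj G u v) *_) (d≗e u v)

arcSum-≅ : {G : Graph M} {H : Graph N} (G≅H : G ≅ H) (d : Fin M → Fin M → ℕ) →
           let π = _≅_.vertices G≅H in
           arcSum G d ≡ arcSum H (λ u v → d (π ⟨$⟩ˡ u) (π ⟨$⟩ˡ v))
arcSum-≅ {M} {N} {G} {H} G≅H d = begin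
  ∑[ u < M ] ∑[ v < M ] (bit (adj G u v) * d u v)
    ≡⟨ ∑-permute _ (flip π) ⟩
  ∑[ u < N ] ∑[ v < M ] (bit (adj G (π ⟨$⟩ˡ u) v) * d (π ⟨$⟩ˡ u) v)
    ≡⟨ sum-cong-≗ (λ u → ∑-permute (λ v → bit (adj G (π ⟨$⟩ˡ u) v) * d (π ⟨$⟩ˡ u) v) (flip π)) ⟩
  ∑[ u < N ] ∑[ v < N ] (bit (adj G (π ⟨$⟩ˡ u) (π ⟨$⟩ˡ v)) * d (π ⟨$⟩ˡ u) (π ⟨$⟩ˡ v))
    ≡⟨ ∑∑-cong (λ u v → cong (λ b → bit b * d (π ⟨$⟩ˡ u) (π ⟨$⟩ˡ v))
         (trans (_≅_.preserve G≅H _ _) (cong₂ (adj H) (inverseʳ π) (inverseʳ π)))) ⟩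
  ∑[ u < N ] ∑[ v < N ] (bit (adj H u v) * d (π ⟨$⟩ˡ u) (π ⟨$⟩ˡ v)) ∎
  where
  open ≡-Reasoning
  π = _≅_.vertices G≅H

-- The adjacency matrix has four blocks: the two graphs on the diagonal, and off it the permutation
-- matrix of `φ` and its transpose, whose double sums collapse to single sums by `∑-δ`.
arcSum-⊕ : (G₁ : Graph N) (φ : Permutation′ N) (G₂ : Graph N)
           (d : Fin N ⊎ Fin N → Fin N ⊎ Fin N → ℕ) →
           arcSum (G₁ ⊕[ φ ] G₂) (λ u v → d (splitAt N u) (splitAt N v)) ≡
           arcSum G₁ (λ u v → d (inj₁ u) (inj₁ v)) + arcSum G₂ (λ u v → d (inj₂ u) (inj₂ v))
           + ∑[ u < N ] (d (inj₁ u) (inj₂ (φ ⟨$⟩ʳ u)) + d (inj₂ (φ ⟨$⟩ʳ u)) (inj₁ u))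
arcSum-⊕ {N} G₁ φ G₂ d = begin
  ∑[ u < N + N ] ∑[ v < N + N ] w (splitAt N u) (splitAt N v)
    ≡⟨ ∑-splitAt N (λ x → ∑[ v < N + N ] w x (splitAt N v)) ⟩
  ∑[ u < N ] ∑[ v < N + N ] w (inj₁ u) (splitAt N v) + ∑[ u < N ] ∑[ v < N + N ] w (inj₂ u) (splitAt N v)
    ≡⟨ cong₂ _+_ (rows inj₁) (rows inj₂) ⟩
  (S₁ + ∑[ u < N ] ∑[ v < N ] w (inj₁ u) (inj₂ v)) + (∑[ u < N ] ∑[ v < N ] w (inj₂ u) (inj₁ v) + S₂)
    ≡⟨ cong₂ (λ x y → (S₁ + x) + (y + S₂)) right left ⟩
  (S₁ + ∑[ u < N ] d (inj₁ u) (inj₂ (φ ⟨$⟩ʳ u))) + (∑[ u < N ] d (inj₂ (φ ⟨$⟩ʳ u)) (inj₁ u) + S₂)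
    ≡⟨ regroup S₁ S₂ _ _ ⟩
  S₁ + S₂ + (∑[ u < N ] d (inj₁ u) (inj₂ (φ ⟨$⟩ʳ u)) + ∑[ u < N ] d (inj₂ (φ ⟨$⟩ʳ u)) (inj₁ u))
    ≡⟨ cong (S₁ + S₂ +_) (∑-distrib-+ {N} _ _) ⟨
  S₁ + S₂ + ∑[ u < N ] (d (inj₁ u) (inj₂ (φ ⟨$⟩ʳ u)) + d (inj₂ (φ ⟨$⟩ʳ u)) (inj₁ u)) ∎
  where
  open ≡-Reasoning
  w : Fin N ⊎ Fin N → Fin N ⊎ Fin N → ℕ
  w x y = bit (⊕-adj G₁ φ G₂ x y) * d x y
  S₁ = arcSum G₁ (λ u v → d (inj₁ u) (inj₁ v))
  S₂ = arcSum G₂ (λ u v → d (inj₂ u) (inj₂ v))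
  rows : (inj : Fin N → Fin N ⊎ Fin N) →
         ∑[ u < N ] ∑[ v < N + N ] w (inj u) (splitAt N v) ≡
         ∑[ u < N ] ∑[ v < N ] w (inj u) (inj₁ v) + ∑[ u < N ] ∑[ v < N ] w (inj u) (inj₂ v)
  rows inj = trans (sum-cong-≗ λ u → ∑-splitAt N (w (inj u))) (∑-distrib-+ {N} _ _)
  right : ∑[ u < N ] ∑[ v < N ] w (inj₁ u) (inj₂ v) ≡ ∑[ u < N ] d (inj₁ u) (inj₂ (φ ⟨$⟩ʳ u))
  right = sum-cong-≗ λ u → ∑-δ (φ ⟨$⟩ʳ u) (λ v → d (inj₁ u) (inj₂ v))
  left : ∑[ u < N ] ∑[ v < N ] w (inj₂ u) (inj₁ v) ≡ ∑[ u < N ] d (inj₂ (φ ⟨$⟩ʳ u)) (inj₁ u)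
  -- In this block the column `v` determines the row `φ v`, so the order of summation is exchanged
  -- before collapsing.
  left = trans (∑-comm {N} {N} _) (sum-cong-≗ λ v → ∑-δ (φ ⟨$⟩ʳ v) (λ u → d (inj₂ u) (inj₁ v)))
  regroup : ∀ a b x y → (a + x) + (y + b) ≡ a + b + (x + y)
  regroup = solve-∀

-- The edge-isoperimetric inequality for BC graphs.

size : (Fin N → Bool) → ℕ
size {N} p = ∑[ u < N ] bit (p u)

cutSize : Graph N → (Fin N → Bool) → ℕ
cutSize G p = arcSum G (λ u v → bit (p u) * bit (not (p v)))

size-cong : {p q : Fin N → Bool} → (∀ u → p u ≡ q u) → size p ≡ size q
size-cong p≗q = sum-cong-≗ (cong bit ∘ p≗q)

cutSize-cong : (G : Graph N) {p q : Fin N → Bool} → (∀ u → p u ≡ q u) → cutSize G p ≡ cutSize G q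
cutSize-cong G p≗q = arcSum-cong G λ u v → cong₂ (λ a b → bit a * bit (not b)) (p≗q u) (p≗q v)

-- In an n-regular graph, `n * size p` is the cut plus twice the number of edges spanned by `p`. For
-- such a graph the bound therefore says that `p` spans at most `maxEdges n (size p)` edges. Stating
-- it through the cut makes a count of spanned edges unnecessary.
record Isoperimetric (n : ℕ) (G : Graph N) : Set where
  constructor isoperimetric
  field
    lower : ∀ p → n * size p ≤ cutSize G p + 2 * maxEdges n (size p)

isoperimetric-≅ : {G : Graph M} {H : Graph N} → G ≅ H → Isoperimetric n H → Isoperimetric n G
isoperimetric-≅ {n = n} G≅H (isoperimetric lower) = isoperimetric λ p →
  subst₂ (λ s c → n * s ≤ c + 2 * maxEdges n s)
    (sym (∑-permute (bit ∘ p) (flip (_≅_.vertices G≅H))))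
    (sym (arcSum-≅ G≅H _))
    (lower (p ∘ (_≅_.vertices G≅H ⟨$⟩ˡ_)))

isoperimetric-K₂ : Isoperimetric 1 K₂
isoperimetric-K₂ = isoperimetric λ p → bound p
  where
  bound : ∀ p → 1 * size p ≤ cutSize K₂ p + 2 * maxEdges 1 (size p)
  bound p with p zero | p (suc zero)
  ... | false | false = z≤n
  ... | false | true  = s≤s z≤n
  ... | true  | false = s≤s z≤n
  ... | true  | true  = s≤s (s≤s z≤n)

-- The booleans tell which ends of one matching edge lie in the set: an edge with one such end is
-- cut, and an edge with two is spanned and counts twice.
overlap-bound : ∀ a b → bit a + bit b ≤ bit a * bit (not b) + bit b * bit (not a) + 2 * bit (a ∧ b)
overlap-bound false false = z≤n
overlap-bound false true  = s≤s z≤n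
overlap-bound true  false = s≤s z≤n
overlap-bound true  true  = s≤s (s≤s z≤n)

bit-∧-≤ˡ : ∀ a b → bit (a ∧ b) ≤ bit a
bit-∧-≤ˡ false b     = z≤n
bit-∧-≤ˡ true  false = z≤n
bit-∧-≤ˡ true  true  = s≤s z≤n

bit-∧-≤ʳ : ∀ a b → bit (a ∧ b) ≤ bit b
bit-∧-≤ʳ false b = z≤n
bit-∧-≤ʳ true  b = ≤-refl

-- The extra degree of each vertex comes from the matching, whose edges are either cut (`X`) or
-- inside the set (`t`). As `t` is at most the size of either half, superadditivity absorbs it
-- together with the two inductive bounds. The predicate is moved to the disjoint union as `q`, and
-- `join-splitAt` leads back to `p`.
isoperimetric-⊕ : {G₁ G₂ : Graph N} (φ : Permutation′ N) →
                  Isoperimetric n G₁ → Isoperimetric n G₂ → Isoperimetric (suc n) (G₁ ⊕[ φ ] G₂)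
isoperimetric-⊕ {N} {n} {G₁} {G₂} φ (isoperimetric lower₁) (isoperimetric lower₂) =
  isoperimetric λ p → let q = p ∘ ⊎⇒Fin N N in
    subst₂ (λ s c → suc n * s ≤ c + 2 * maxEdges (suc n) s)
      (trans (sym (∑-splitAt N (bit ∘ q))) (size-cong (cong p ∘ join-splitAt N N)))
      (trans (sym (arcSum-⊕ G₁ φ G₂ (λ x y → bit (q x) * bit (not (q y)))))
             (cutSize-cong (G₁ ⊕[ φ ] G₂) (cong p ∘ join-splitAt N N)))
      (bound q)
  where
  bound : (q : Fin N ⊎ Fin N → Bool) →
          let q₁ = q ∘ inj₁ ; q₂ = q ∘ inj₂ ; s = size q₁ + size q₂ in
          suc n * s ≤ cutSize G₁ q₁ + cutSize G₂ q₂
                      + ∑[ u < N ] (bit (q₁ u) * bit (not (q₂ (φ ⟨$⟩ʳ u)))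
                                    + bit (q₂ (φ ⟨$⟩ʳ u)) * bit (not (q₁ u)))
                      + 2 * maxEdges (suc n) s
  bound q = begin
    suc n * (a + c)
      ≡⟨ expand n a c ⟩
    n * a + n * c + (a + c)
      ≤⟨ +-mono-≤ (+-mono-≤ (lower₁ q₁) (lower₂ q₂)) matching ⟩
    (C₁ + 2 * E a) + (C₂ + 2 * E c) + (X + 2 * t)
      ≡⟨ regroup C₁ C₂ X (E a) (E c) t ⟩
    C₁ + C₂ + X + 2 * (E a + E c + t)
      ≤⟨ +-monoʳ-≤ (C₁ + C₂ + X) (*-monoʳ-≤ 2 (maxEdges-superadditive n t≤a t≤c)) ⟩
    C₁ + C₂ + X + 2 * maxEdges (suc n) (a + c) ∎
    where
    open ≤-Reasoning
    q₁ = q ∘ inj₁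
    q₂ = q ∘ inj₂
    a = size q₁
    c = size q₂
    C₁ = cutSize G₁ q₁
    C₂ = cutSize G₂ q₂
    E = maxEdges n
    X = ∑[ u < N ] (bit (q₁ u) * bit (not (q₂ (φ ⟨$⟩ʳ u))) + bit (q₂ (φ ⟨$⟩ʳ u)) * bit (not (q₁ u)))
    t = ∑[ u < N ] bit (q₁ u ∧ q₂ (φ ⟨$⟩ʳ u))
    c≡ : c ≡ ∑[ u < N ] bit (q₂ (φ ⟨$⟩ʳ u))
    c≡ = ∑-permute (bit ∘ q₂) φ
    t≤a : t ≤ a
    t≤a = ∑-mono-≤ λ u → bit-∧-≤ˡ (q₁ u) _
    t≤c : t ≤ c
    t≤c = ≤-trans (∑-mono-≤ λ u → bit-∧-≤ʳ (q₁ u) _) (≤-reflexive (sym c≡))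
    matching : a + c ≤ X + 2 * t
    matching = begin
      a + c
        ≡⟨ cong (a +_) c≡ ⟩
      a + ∑[ u < N ] bit (q₂ (φ ⟨$⟩ʳ u))
        ≡⟨ ∑-distrib-+ {N} _ _ ⟨
      ∑[ u < N ] (bit (q₁ u) + bit (q₂ (φ ⟨$⟩ʳ u)))
        ≤⟨ ∑-mono-≤ (λ u → overlap-bound (q₁ u) (q₂ (φ ⟨$⟩ʳ u))) ⟩
      ∑[ u < N ] (bit (q₁ u) * bit (not (q₂ (φ ⟨$⟩ʳ u))) + bit (q₂ (φ ⟨$⟩ʳ u)) * bit (not (q₁ u))
                  + 2 * bit (q₁ u ∧ q₂ (φ ⟨$⟩ʳ u)))
        ≡⟨ ∑-distrib-+ {N} _ _ ⟩
      X + ∑[ u < N ] (2 * bit (q₁ u ∧ q₂ (φ ⟨$⟩ʳ u)))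
        ≡⟨ cong (X +_) (*-distribˡ-sum {N} 2 _) ⟨
      X + 2 * t ∎
    expand : ∀ n a c → suc n * (a + c) ≡ n * a + n * c + (a + c)
    expand = solve-∀
    regroup : ∀ C₁ C₂ X x y t → (C₁ + 2 * x) + (C₂ + 2 * y) + (X + 2 * t) ≡ C₁ + C₂ + X + 2 * (x + y + t)
    regroup = solve-∀

ℓ-isoperimetric : {G : Graph N} → ℓ n G → Isoperimetric n G
ℓ-isoperimetric (base G≅K₂)          = isoperimetric-≅ G≅K₂ isoperimetric-K₂
ℓ-isoperimetric (join φ ℓ₁ ℓ₂ G≅⊕) =
  isoperimetric-≅ G≅⊕ (isoperimetric-⊕ φ (ℓ-isoperimetric ℓ₁) (ℓ-isoperimetric ℓ₂))

-- From filtered lists to sums: edge boundaries.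

sum-map-filter : ∀ {A : Set} {P : Pred A 0ℓ} (P? : Decidable P) (w : A → ℕ) xs →
                 sum (map w (filter P? xs)) ≡ sum (map (λ x → bit (does (P? x)) * w x) xs)
sum-map-filter P? w []       = refl
sum-map-filter P? w (x ∷ xs) with does (P? x)
... | false = sum-map-filter P? w xs
... | true  = cong₂ _+_ (sym (+-identityʳ (w x))) (sum-map-filter P? w xs)

sum-map-tabulate : ∀ {A : Set} (w : A → ℕ) (f : Fin n → A) →
                   sum (map w (tabulate f)) ≡ ∑[ i < n ] w (f i)
sum-map-tabulate {zero}  w f = refl
sum-map-tabulate {suc n} w f = cong (w (f zero) +_) (sum-map-tabulate w (f ∘ suc))

sum-map-cartesianProduct : ∀ {A B : Set} (w : A × B → ℕ) (f : Fin m → A) (g : Fin n → B) →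
  sum (map w (cartesianProduct (tabulate f) (tabulate g))) ≡ ∑[ i < m ] ∑[ j < n ] w (f i , g j)
sum-map-cartesianProduct {zero}          w f g = refl
sum-map-cartesianProduct {suc m} {n} {A} {B} w f g = begin
  sum (map w (map (f zero ,_) ys ++ rest))
    ≡⟨ cong sum (map-++ w (map (f zero ,_) ys) rest) ⟩
  sum (map w (map (f zero ,_) ys) ++ map w rest)
    ≡⟨ sum-++ (map w (map (f zero ,_) ys)) (map w rest) ⟩
  sum (map w (map (f zero ,_) ys)) + sum (map w rest)
    ≡⟨ cong₂ _+_ (trans (cong sum (sym (map-∘ ys))) (sum-map-tabulate (λ b → w (f zero , b)) g))
                 (sum-map-cartesianProduct w (f ∘ suc) g) ⟩
  ∑[ j < n ] w (f zero , g j) + ∑[ i < m ] ∑[ j < n ] w (f (suc i) , g j) ∎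
  where
  open ≡-Reasoning
  ys = tabulate g
  rest = cartesianProduct (tabulate (f ∘ suc)) ys

length≡sum : ∀ {A : Set} (xs : List A) → length xs ≡ sum (map (const 1) xs)
length≡sum []       = refl
length≡sum (x ∷ xs) = cong suc (length≡sum xs)

does-∈? : ∀ (u : Fin N) (A : Subset N) → does (u ∈? A) ≡ Vec.lookup A u
does-∈? zero    (true  Vec.∷ A) = refl
does-∈? zero    (false Vec.∷ A) = refl
does-∈? (suc u) (_     Vec.∷ A) = does-∈? u A

size-lookup : (A : Subset N) → size (Vec.lookup A) ≡ ∣ A ∣
size-lookup Vec.[]            = refl
size-lookup (true  Vec.∷ A) = cong suc (size-lookup A)
size-lookup (false Vec.∷ A) = size-lookup A

length-boundary : (G : Graph N) (A : Subset N) → length (boundary G A) ≡ cutSize G (Vec.lookup A)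
length-boundary {N} G A = begin
  length (boundary G A)
    ≡⟨ length≡sum (boundary G A) ⟩
  sum (map (const 1) (boundary G A))
    ≡⟨ sum-map-filter _ (const 1) (cartesianProduct (allFin N) (allFin N)) ⟩
  sum (map (λ (u , v) → bit (adj G u v ∧ (does (u ∈? A) ∧ not (does (v ∈? A)))) * 1)
           (cartesianProduct (allFin N) (allFin N)))
    ≡⟨ sum-map-cartesianProduct {N} {N} _ (λ i → i) (λ i → i) ⟩
  ∑[ u < N ] ∑[ v < N ] (bit (adj G u v ∧ (does (u ∈? A) ∧ not (does (v ∈? A)))) * 1)
    ≡⟨ ∑∑-cong (λ u v → trans (*-identityʳ _) (trans (bit-∧ (adj G u v) _)
         (cong (bit (adj G u v) *_) (trans (bit-∧ (does (u ∈? A)) _)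
           (cong₂ (λ a b → bit a * bit (not b)) (does-∈? u A) (does-∈? v A)))))) ⟩
  cutSize G (Vec.lookup A) ∎
  where open ≡-Reasoning

-- Because `m ≤ N`, the minimum is attained by an actual set of size `m` and is not the default
-- value of `minimum` on an empty list. The isoperimetric bound is applied to that set.
θ-lower : (G : Graph N) → Isoperimetric n G → ∀ {m} → m ≤ N → n * m ≤ θ G m + 2 * maxEdges n m
θ-lower {n = n} G iso m≤N with θ-attained G m≤N
... | A , refl , eq = subst₂ (λ s c → n * s ≤ c + 2 * maxEdges n s)
  (size-lookup A) (trans (sym (length-boundary G A)) eq)
  (Isoperimetric.lower iso (Vec.lookup A))

-- The cost of an arrangement as a sum of cuts.

-- Truncated subtraction makes the backward orientation of an edge weigh 0, so every edge
-- contributes its length once.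
forwardLength : Graph N → (Fin N → ℕ) → ℕ
forwardLength G f = arcSum G (λ u v → f v ∸ f u)

∣-∣≡∸+∸ : ∀ x y → ∣ x - y ∣ ≡ (y ∸ x) + (x ∸ y)
∣-∣≡∸+∸ zero    zero    = refl
∣-∣≡∸+∸ zero    (suc y) = sym (+-identityʳ (suc y))
∣-∣≡∸+∸ (suc x) zero    = refl
∣-∣≡∸+∸ (suc x) (suc y) = ∣-∣≡∸+∸ x y

-- `LA` orients edges by vertex number, `forwardLength` by position. The absolute difference is
-- split into its two truncated differences, and the second is carried to the reversed pair by
-- symmetry of adjacency and an exchange of sums. The shift of positions by one disappears by
-- computation.
LA≡forwardLength : (G : Graph N) (f : Permutation′ N) →
                   LA G f ≡ forwardLength G (λ v → toℕ (f ⟨$⟩ʳ v))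
LA≡forwardLength {N} G f = begin
  LA G f
    ≡⟨ sum-map-filter _ _ (cartesianProduct (allFin N) (allFin N)) ⟩
  sum (map (λ (u , v) → bit (lt u v ∧ adj G u v) * ∣ pos u - pos v ∣)
           (cartesianProduct (allFin N) (allFin N)))
    ≡⟨ sum-map-cartesianProduct {N} {N} _ (λ i → i) (λ i → i) ⟩
  ∑[ u < N ] ∑[ v < N ] (bit (lt u v ∧ adj G u v) * ∣ pos u - pos v ∣)
    ≡⟨ ∑∑-cong (λ u v → trans (cong₂ _*_ (bit-∧ (lt u v) _) (∣-∣≡∸+∸ (pos u) (pos v)))
                              (expand (bit (lt u v)) (bit (adj G u v)) _ _)) ⟩
  ∑[ u < N ] ∑[ v < N ] (bit (lt u v) * w u v + bit (lt u v) * (bit (adj G u v) * (pos u ∸ pos v)))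
    ≡⟨ ∑∑-cong (λ u v → cong (λ b → bit (lt u v) * w u v + bit (lt u v) * (bit b * (pos u ∸ pos v)))
                             (symmetric G u v)) ⟩
  ∑[ u < N ] ∑[ v < N ] (bit (lt u v) * w u v + bit (lt u v) * w v u)
    ≡⟨ ∑∑-distrib-+ _ _ ⟩
  ∑[ u < N ] ∑[ v < N ] (bit (lt u v) * w u v) + ∑[ u < N ] ∑[ v < N ] (bit (lt u v) * w v u)
    ≡⟨ cong (∑[ u < N ] ∑[ v < N ] (bit (lt u v) * w u v) +_) (∑-comm {N} {N} _) ⟩
  ∑[ u < N ] ∑[ v < N ] (bit (lt u v) * w u v) + ∑[ u < N ] ∑[ v < N ] (bit (lt v u) * w u v)
    ≡⟨ ∑∑-distrib-+ _ _ ⟨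
  ∑[ u < N ] ∑[ v < N ] (bit (lt u v) * w u v + bit (lt v u) * w u v)
    ≡⟨ ∑∑-cong one-orientation ⟩
  ∑[ u < N ] ∑[ v < N ] w u v ∎
  where
  open ≡-Reasoning
  pos : Fin N → ℕ
  pos v = toℕ (f ⟨$⟩ʳ v)
  lt : Fin N → Fin N → Bool
  lt u v = does (u <? v)
  w : Fin N → Fin N → ℕ
  w u v = bit (adj G u v) * (pos v ∸ pos u)
  expand : ∀ l a x y → l * a * (x + y) ≡ l * (a * x) + l * (a * y)
  expand = solve-∀
  ∑∑-distrib-+ : (g h : Fin N → Fin N → ℕ) →
    ∑[ u < N ] ∑[ v < N ] (g u v + h u v) ≡ ∑[ u < N ] ∑[ v < N ] g u v + ∑[ u < N ] ∑[ v < N ] h u v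
  ∑∑-distrib-+ g h = trans (sum-cong-≗ λ u → ∑-distrib-+ (g u) (h u)) (∑-distrib-+ {N} _ _)
  -- Off the diagonal exactly one of the two comparisons holds. On the diagonal both fail, and the
  -- right-hand side vanishes by looplessness.
  one-orientation : ∀ u v → bit (lt u v) * w u v + bit (lt v u) * w u v ≡ w u v
  one-orientation u v with <-cmp u v
  ... | tri< u<v _ v≮u rewrite dec-true (u <? v) u<v | dec-false (v <? u) v≮u =
    trans (+-identityʳ _) (+-identityʳ _)
  ... | tri> u≮v _ v<u rewrite dec-true (v <? u) v<u | dec-false (u <? v) u≮v = +-identityʳ _
  ... | tri≈ u≮u refl _ rewrite dec-false (u <? u) u≮u | loopless G u = refl

-- When x < y, the nonzero terms are those at x ≤ i < y.
∸-layers : ∀ n {x y} → y ≤ n →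
           y ∸ x ≡ ∑[ i < n ] (bit (x <ᵇ suc (toℕ i)) * bit (not (y <ᵇ suc (toℕ i))))
∸-layers zero    {x}     {zero}  y≤n       = 0∸n≡0 x
∸-layers (suc n) {zero}  {zero}  y≤n       = ∸-layers n {0} {0} z≤n
∸-layers (suc n) {zero}  {suc y} (s≤s y≤n) = cong suc (∸-layers n {0} y≤n)
∸-layers (suc n) {suc x} {zero}  y≤n       =
  trans (sym (0∸n≡0 x)) (∸-layers n {x} {0} z≤n)
∸-layers (suc n) {suc x} {suc y} (s≤s y≤n) = ∸-layers n {x} {y} y≤n

size-initial : ∀ {m n} → m ≤ n → ∑[ v < n ] bit (toℕ v <ᵇ m) ≡ m
size-initial {n = n} z≤n = sum-replicate-zero n
size-initial (s≤s m≤n) = cong suc (size-initial m≤n)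

-- Double counting of edges against gaps of the path: the length of an edge is the number of gaps it
-- passes over, and the edges over gap `i` form the cut between the positions up to `i` and the
-- later ones.
forwardLength-layers : (G : Graph N) (f : Fin N → ℕ) → (∀ v → f v ≤ n) →
  forwardLength G f ≡ ∑[ i < n ] cutSize G (λ v → f v <ᵇ suc (toℕ i))
forwardLength-layers {N} {n} G f f≤n = begin
  ∑[ u < N ] ∑[ v < N ] (bit (adj G u v) * (f v ∸ f u))
    ≡⟨ ∑∑-cong (λ u v → trans (cong (bit (adj G u v) *_) (∸-layers n {f u} (f≤n v)))
                              (*-distribˡ-sum {n} (bit (adj G u v)) _)) ⟩
  ∑[ u < N ] ∑[ v < N ] ∑[ i < n ] c u v i
    ≡⟨ sum-cong-≗ (λ u → ∑-comm {N} {n} (c u)) ⟩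
  ∑[ u < N ] ∑[ i < n ] ∑[ v < N ] c u v i
    ≡⟨ ∑-comm {N} {n} (λ u i → ∑[ v < N ] c u v i) ⟩
  ∑[ i < n ] ∑[ u < N ] ∑[ v < N ] c u v i ∎
  where
  open ≡-Reasoning
  c : Fin N → Fin N → Fin n → ℕ
  c u v i = bit (adj G u v) * (bit (f u <ᵇ suc (toℕ i)) * bit (not (f v <ᵇ suc (toℕ i))))

-- The vertices at positions up to `i` form a set of size `i + 1`, which is one competitor in the
-- minimum defining `θ`. A path on `suc n` vertices has `n` gaps, so the sizes run from 1 to `n`.
∑θ≤LA : (G : Graph (suc n)) (f : Permutation′ (suc n)) → ∑[ i < n ] θ G (suc (toℕ i)) ≤ LA G f
∑θ≤LA {n} G f = begin
  ∑[ i < n ] θ G (suc (toℕ i))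
    ≤⟨ ∑-mono-≤ layer ⟩
  ∑[ i < n ] cutSize G (λ v → toℕ (f ⟨$⟩ʳ v) <ᵇ suc (toℕ i))
    ≡⟨ forwardLength-layers G _ (λ v → ≤-pred (toℕ<n (f ⟨$⟩ʳ v))) ⟨
  forwardLength G (λ v → toℕ (f ⟨$⟩ʳ v))
    ≡⟨ LA≡forwardLength G f ⟨
  LA G f ∎
  where
  open ≤-Reasoning
  layer : (i : Fin n) → θ G (suc (toℕ i)) ≤ cutSize G (λ v → toℕ (f ⟨$⟩ʳ v) <ᵇ suc (toℕ i))
  layer i = subst₂ _≤_ (cong (θ G) ∣A∣≡)
    (trans (length-boundary G A) (cutSize-cong G (lookup∘tabulate p)))
    (θ-≤ G A)
    where
    p : Fin (suc n) → Bool
    p v = toℕ (f ⟨$⟩ʳ v) <ᵇ suc (toℕ i)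
    A : Subset (suc n)
    A = Vec.tabulate p
    ∣A∣≡ : ∣ A ∣ ≡ suc (toℕ i)
    ∣A∣≡ = trans (sym (size-lookup A)) (trans (size-cong (lookup∘tabulate p))
      (trans (sym (∑-permute (λ v → bit (toℕ v <ᵇ suc (toℕ i))) f))
             (size-initial (s≤s (<⇒≤ (toℕ<n i))))))

-- An arrangement of cost N(N - 1)/2.

-- 2 · forwardLength + N ≡ N² says that f has cost N(N − 1)/2.
record Arrangement (G : Graph N) : Set where
  constructor arrangement
  field
    order : Permutation′ N
    cost  : 2 * forwardLength G (λ v → toℕ (order ⟨$⟩ʳ v)) + N ≡ N * N

arrangement-≅ : {G : Graph M} {H : Graph N} → G ≅ H → Arrangement H → Arrangement G
arrangement-≅ {M} {G = G} {H} G≅H (arrangement f cost) with ↔⇒≡ (_≅_.vertices G≅H)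
... | refl = arrangement (π ∘ₚ f) (subst (λ l → 2 * l + M ≡ M * M) (sym same) cost)
  where
  π = _≅_.vertices G≅H
  same : forwardLength G (λ v → toℕ (f ⟨$⟩ʳ (π ⟨$⟩ʳ v))) ≡ forwardLength H (λ v → toℕ (f ⟨$⟩ʳ v))
  same = trans (arcSum-≅ G≅H _) (arcSum-cong H λ u v →
    cong₂ (λ x y → toℕ (f ⟨$⟩ʳ y) ∸ toℕ (f ⟨$⟩ʳ x)) (inverseʳ π) (inverseʳ π))

-- `G₁` takes the first `N` positions and `G₂` the last `N`. The inner costs are unchanged by the
-- translation, and the matching costs `N * N` for every `φ`, since its total length depends only on
-- the sums of positions in the two halves.
arrangement-⊕ : {G₁ G₂ : Graph N} (φ : Permutation′ N) →
                Arrangement G₁ → Arrangement G₂ → Arrangement (G₁ ⊕[ φ ] G₂)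
arrangement-⊕ {N} {G₁} {G₂} φ (arrangement f₁ cost₁) (arrangement f₂ cost₂) =
  arrangement f (begin
    2 * forwardLength (G₁ ⊕[ φ ] G₂) (λ v → toℕ (f ⟨$⟩ʳ v)) + (N + N)
      ≡⟨ cong (λ l → 2 * l + (N + N)) total ⟩
    2 * (L₁ + L₂ + N * N) + (N + N)
      ≡⟨ regroup L₁ L₂ N ⟩
    (2 * L₁ + N) + (2 * L₂ + N) + 2 * (N * N)
      ≡⟨ cong₂ (λ x y → x + y + 2 * (N * N)) cost₁ cost₂ ⟩
    N * N + N * N + 2 * (N * N)
      ≡⟨ square N ⟩
    (N + N) * (N + N) ∎)
  where
  open ≡-Reasoning
  p₁ p₂ : Fin N → ℕ
  p₁ u = toℕ (f₁ ⟨$⟩ʳ u)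
  p₂ u = toℕ (f₂ ⟨$⟩ʳ u)
  L₁ = forwardLength G₁ p₁
  L₂ = forwardLength G₂ p₂

  f : Permutation′ (N + N)
  f = ↔-sym +↔⊎ ↔-∘ ((f₁ ⊎-↔ f₂) ↔-∘ +↔⊎)

  p : Fin N ⊎ Fin N → ℕ
  p (inj₁ u) = p₁ u
  p (inj₂ u) = N + p₂ u
  f≡p : ∀ v → toℕ (f ⟨$⟩ʳ v) ≡ p (splitAt N v)
  f≡p v with splitAt N v
  ... | inj₁ u = toℕ-↑ˡ (f₁ ⟨$⟩ʳ u) N
  ... | inj₂ u = toℕ-↑ʳ N (f₂ ⟨$⟩ʳ u)

  X : ℕ
  X = ∑[ u < N ] ((N + p₂ (φ ⟨$⟩ʳ u) ∸ p₁ u) + (p₁ u ∸ (N + p₂ (φ ⟨$⟩ʳ u))))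

  T = ∑[ u < N ] toℕ u

  -- `X` contains both orientations of each matching edge. The backward one truncates to 0, and
  -- adding `a` undoes the forward subtraction.
  gap : ∀ {a b} → a ≤ b → (b ∸ a) + (a ∸ b) + a ≡ b
  gap {a} {b} a≤b rewrite m≤n⇒m∸n≡0 a≤b | +-identityʳ (b ∸ a) = m∸n+n≡m a≤b

  -- Adding the positions in the first half, whose sum is `T`, removes all subtractions. The
  -- unshifted positions of the partners under `φ` also sum to `T`, so it cancels and the `N` shifts
  -- by `N` remain.
  X≡N² : X ≡ N * N
  X≡N² = +-cancelʳ-≡ T X (N * N) (begin
    X + T
      ≡⟨ cong (X +_) (∑-permute toℕ f₁) ⟩
    X + ∑[ u < N ] p₁ u
      ≡⟨ ∑-distrib-+ {N} _ _ ⟨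
    ∑[ u < N ] ((N + p₂ (φ ⟨$⟩ʳ u) ∸ p₁ u) + (p₁ u ∸ (N + p₂ (φ ⟨$⟩ʳ u))) + p₁ u)
      ≡⟨ sum-cong-≗ (λ u → gap (≤-trans (<⇒≤ (toℕ<n (f₁ ⟨$⟩ʳ u))) (m≤m+n N _))) ⟩
    ∑[ u < N ] (N + p₂ (φ ⟨$⟩ʳ u))
      ≡⟨ ∑-distrib-+ {N} _ _ ⟩
    ∑[ u < N ] N + ∑[ u < N ] p₂ (φ ⟨$⟩ʳ u)
      ≡⟨ cong₂ _+_ (∑-const N N) (sym (trans (∑-permute toℕ f₂) (∑-permute p₂ φ))) ⟩
    N * N + T ∎)

  total : forwardLength (G₁ ⊕[ φ ] G₂) (λ v → toℕ (f ⟨$⟩ʳ v)) ≡ L₁ + L₂ + N * N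
  total = begin
    forwardLength (G₁ ⊕[ φ ] G₂) (λ v → toℕ (f ⟨$⟩ʳ v))
      ≡⟨ arcSum-cong (G₁ ⊕[ φ ] G₂) (λ u v → cong₂ _∸_ (f≡p v) (f≡p u)) ⟩
    forwardLength (G₁ ⊕[ φ ] G₂) (p ∘ splitAt N)
      ≡⟨ arcSum-⊕ G₁ φ G₂ (λ x y → p y ∸ p x) ⟩
    L₁ + forwardLength G₂ (λ u → N + p₂ u) + X
      ≡⟨ cong₂ (λ l x → L₁ + l + x)
           (arcSum-cong G₂ λ u v → [m+n]∸[m+o]≡n∸o N (p₂ v) (p₂ u)) X≡N² ⟩
    L₁ + L₂ + N * N ∎

  regroup : ∀ a b N → 2 * (a + b + N * N) + (N + N) ≡ (2 * a + N) + (2 * b + N) + 2 * (N * N)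
  regroup = solve-∀
  square : ∀ N → N * N + N * N + 2 * (N * N) ≡ (N + N) * (N + N)
  square = solve-∀

ℓ-arrangement : {G : Graph N} → ℓ n G → Arrangement G
ℓ-arrangement (base G≅K₂)        = arrangement-≅ G≅K₂ (arrangement id refl)
ℓ-arrangement (join φ ℓ₁ ℓ₂ G≅⊕) =
  arrangement-≅ G≅⊕ (arrangement-⊕ φ (ℓ-arrangement ℓ₁) (ℓ-arrangement ℓ₂))

-- Summing the bounds and comparing the three quantities.

ℓ-order : {G : Graph N} → ℓ n G → N ≡ 2 ^ n
ℓ-order (base G≅K₂) = ↔⇒≡ (_≅_.vertices G≅K₂)
ℓ-order {n = suc n} (join φ ℓ₁ _ G≅⊕) = trans (↔⇒≡ (_≅_.vertices G≅⊕))
  (trans (cong₂ _+_ (ℓ-order ℓ₁) (ℓ-order ℓ₁)) (sym (2^-double n)))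

-- The bounds of `θ-lower` are added over all sizes, and the two resulting sums are evaluated by
-- `∑-toℕ` and `∑-maxEdges`. Both produce the term `n * (P * P)`, which is carried on both sides and
-- cancelled at the end to avoid subtraction.
∑θ-lower : ∀ {q} (G : Graph (suc q)) → suc q ≡ 2 ^ n → Isoperimetric n G →
           suc q * suc q ≤ 2 * ∑[ i < q ] θ G (suc (toℕ i)) + suc q
∑θ-lower {n} {q} G order iso = +-cancelˡ-≤ (n * (P * P)) _ _ (begin
  n * (P * P) + P * P
    ≡⟨ cong (λ x → n * x + P * P) (∑-toℕ P) ⟨
  n * (2 * T + P) + P * P
    ≡⟨ regroup₁ n T P ⟩
  2 * (n * T) + (P * P + n * P)
    ≤⟨ +-monoˡ-≤ (P * P + n * P) (*-monoʳ-≤ 2 summed) ⟩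
  2 * (S + 2 * H) + (P * P + n * P)
    ≡⟨ regroup₂ n S H P ⟩
  2 * S + (4 * H + (P * P + n * P))
    ≡⟨ cong (2 * S +_) (subst (λ p → 4 * ∑[ i < p ] maxEdges n (toℕ i) + (p * p + n * p) ≡ n * (p * p) + p)
                              (sym order) (∑-maxEdges n)) ⟩
  2 * S + (n * (P * P) + P)
    ≡⟨ regroup₃ S (n * (P * P)) P ⟩
  n * (P * P) + (2 * S + P) ∎)
  where
  open ≤-Reasoning
  P = suc q
  S = ∑[ i < q ] θ G (suc (toℕ i))
  T = ∑[ i < P ] toℕ i
  H = ∑[ i < P ] maxEdges n (toℕ i)
  summed : n * T ≤ S + 2 * H
  summed = begin
    -- `T` and `H` start at index 0, the sum of `θ` at size 1. Index 0 adds nothing to `T`, and the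
    -- term `maxEdges n 0` of `H` is restored in the last inequality.
    n * ∑[ i < q ] suc (toℕ i)
      ≡⟨ *-distribˡ-sum {q} n _ ⟩
    ∑[ i < q ] (n * suc (toℕ i))
      ≤⟨ ∑-mono-≤ (λ i → θ-lower G iso (s≤s (<⇒≤ (toℕ<n i)))) ⟩
    ∑[ i < q ] (θ G (suc (toℕ i)) + 2 * maxEdges n (suc (toℕ i)))
      ≡⟨ trans (∑-distrib-+ {q} _ _) (cong (S +_) (sym (*-distribˡ-sum {q} 2 _))) ⟩
    S + 2 * ∑[ i < q ] maxEdges n (suc (toℕ i))
      ≤⟨ +-monoʳ-≤ S (*-monoʳ-≤ 2 (m≤n+m _ (maxEdges n 0))) ⟩
    S + 2 * H ∎
  regroup₁ : ∀ n T P → n * (2 * T + P) + P * P ≡ 2 * (n * T) + (P * P + n * P)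
  regroup₁ = solve-∀
  regroup₂ : ∀ n S H P → 2 * (S + 2 * H) + (P * P + n * P) ≡ 2 * S + (4 * H + (P * P + n * P))
  regroup₂ = solve-∀
  regroup₃ : ∀ S x P → 2 * S + (x + P) ≡ x + (2 * S + P)
  regroup₃ = solve-∀

-- The cost of `f` is exactly the lower bound that `∑θ-lower` gives for the sum of `θ`. This closes
-- the cycle from `MinLA G` to `LA G f`, to the sum, and back to `MinLA G`.
MinLA≡∑θ : ∀ {q} (G : Graph (suc q)) → suc q ≡ 2 ^ n → Isoperimetric n G → Arrangement G →
           MinLA G ≡ ∑[ i < q ] θ G (suc (toℕ i)) ×
           2 * ∑[ i < q ] θ G (suc (toℕ i)) + suc q ≡ suc q * suc q
MinLA≡∑θ {q = q} G order iso (arrangement f cost) =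
  ≤-antisym (≤-trans (MinLA-≤ G f) LA≤∑θ) ∑θ≤MinLA ,
  ≤-antisym (≤-trans (+-monoˡ-≤ (suc q) (*-monoʳ-≤ 2 (∑θ≤LA G f))) (≤-reflexive LA-cost))
            (∑θ-lower G order iso)
  where
  LA-cost : 2 * LA G f + suc q ≡ suc q * suc q
  LA-cost = subst (λ l → 2 * l + suc q ≡ suc q * suc q) (sym (LA≡forwardLength G f)) cost
  LA≤∑θ : LA G f ≤ ∑[ i < q ] θ G (suc (toℕ i))
  LA≤∑θ = *-cancelˡ-≤ 2 (+-cancelʳ-≤ (suc q) _ _
    (≤-trans (≤-reflexive LA-cost) (∑θ-lower G order iso)))
  ∑θ≤MinLA : ∑[ i < q ] θ G (suc (toℕ i)) ≤ MinLA G
  ∑θ≤MinLA with MinLA-attained G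
  ... | g , eq = ≤-trans (∑θ≤LA G g) (≤-reflexive eq)

theorem3p5 : ∀ (n : ℕ) → 1 ≤ n → ∀ {N : ℕ} (X : Graph N) → ℓ n X →
    (MinLA X ≡ sum (applyUpTo (λ i → θ X (suc i)) (2 ^ n ∸ 1)))
    × (sum (applyUpTo (λ i → θ X (suc i)) (2 ^ n ∸ 1)) ≡ 2 ^ (n ∸ 1) * (2 ^ n ∸ 1))
theorem3p5 (suc k) _ {zero} X X∈ℓ = contradiction (ℓ-order X∈ℓ) (<⇒≢ (m^n>0 2 (suc k)))
theorem3p5 (suc k) _ {suc q} X X∈ℓ =
  -- The number of gaps is `q`, the predecessor of the order, and `order` identifies it with
  -- `2 ^ suc k ∸ 1` in the range and in the closed form at once.
  subst (λ r → (MinLA X ≡ sum (applyUpTo θ₊ r)) × (sum (applyUpTo θ₊ r) ≡ 2 ^ k * r))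
        (cong pred order)
        (subst (λ s → (MinLA X ≡ s) × (s ≡ 2 ^ k * q)) (sym (sum-applyUpTo θ₊ q))
               (MinLA≡S , S≡))
  where
  open ≡-Reasoning
  order : suc q ≡ 2 ^ suc k
  order = ℓ-order X∈ℓ
  θ₊ : ℕ → ℕ
  θ₊ i = θ X (suc i)
  S : ℕ
  S = ∑[ i < q ] θ₊ (toℕ i)
  bounds : MinLA X ≡ S × 2 * S + suc q ≡ suc q * suc q
  bounds = MinLA≡∑θ X order (ℓ-isoperimetric X∈ℓ) (ℓ-arrangement X∈ℓ)
  MinLA≡S : MinLA X ≡ S
  MinLA≡S = proj₁ bounds
  S≡ : S ≡ 2 ^ k * q
  S≡ = *-cancelˡ-≡ S (2 ^ k * q) 2 (+-cancelʳ-≡ (suc q) (2 * S) (2 * (2 ^ k * q)) (begin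
    2 * S + suc q             ≡⟨ proj₂ bounds ⟩
    suc q * suc q             ≡⟨ trans (*-suc (suc q) q) (+-comm (suc q) (suc q * q)) ⟩
    suc q * q + suc q         ≡⟨ cong (λ p → p * q + suc q) order ⟩
    2 * 2 ^ k * q + suc q     ≡⟨ cong (_+ suc q) (*-assoc 2 (2 ^ k) q) ⟩
    2 * (2 ^ k * q) + suc q   ∎))
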